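{- Let $j\ge 4$ be an integer, and write $\rho_i=\rho_i(F_j,1)$ for the residue of $F_i$ modulo $F_j$ with $0\le\rho_i\le F_j-1$. (i) If $j$ is even, then $\pi(F_j,1)=2j$ and the values of $\rho_i$ for $i\in\{0,\ldots,2j-1\}$ are (i.1) $\rho_i=F_i$ if $i<j$; (i.2) $\rho_i=0$ if $i=j$; (i.3) $\rho_i=F_{2j-i}$ if $j<i<2j$ and $i$ is odd; (i.4) $\rho_i=F_j-F_{2j-i}$ if $j<i<2j$ and $i$ is even. (ii) If $j$ is odd, then $\pi(F_j,1)=4j$ and the values of $\rho_i$ for $i\in\{0,\ldots,4j-1\}$ are (ii.1) $\rho_i=F_i$ if $i<j$; (ii.2) $\rho_i=0$ if $i=j$; (ii.3) $\rho_i=F_{2j-i}$ if $j<i<2j$ and $i$ is even; (ii.4) $\rho_i=F_j-F_{2j-i}$ if $j<i<2j$ and $i$ is odd; (ii.5) $\rho_i=0$ if $i=2j$; (ii.6) $\rho_i=F_j-F_{i-2j}$ if $2j<i<3j$; (ii.7) $\rho_i=0$ if $i=3j$; (ii.8) $\rho_i=F_j-F_{4j-i}$ if $3j<i<4j$ and $i$ is even; (ii.9) $\rho_i=F_{4j-i}$ if $3j<i<4j$ and $i$ is odd.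
   Context: The Fibonacci numbers are $F_0=0$, $F_1=1$, $F_{i+1}=F_i+F_{i-1}$ for $i\ge 1$. For integers $j\ge 1$, $e\ge 1$, $\rho_i(F_j,e)$ is the integer with $\rho_i(F_j,e)\equiv F_i^e\pmod{F_j}$ and $0\le\rho_i(F_j,e)\le F_j-1$. A sequence $(a_i:i\ge 0)$ is periodic if there is an integer $p\ge 1$, called a period, with $a_{i+p}=a_i$ for all $i\ge 0$. $\pi(F_j,e)$ denotes the periodicity, i.e. the minimum period, of the sequence $\mathcal{F}^e(F_j)=(F_i^e \bmod F_j: i\ge 0)$. -}

module Defs where

open import Data.Nat using (ℕ; zero; suc; _+_; _^_; _%_; _≤_; z≤n; s≤s; NonZero; >-nonZero)
open import Data.Nat.Divisibility using (_∣_)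
open import Data.Nat.Properties using (≤-trans; m≤m+n; ≤-refl)
open import Data.Product using (_×_)
open import Relation.Binary.PropositionalEquality using (_≡_)
open import Relation.Nullary using (¬_)

fib : ℕ → ℕ
fib 0 = 0
fib 1 = 1
fib (suc (suc i)) = fib (suc i) + fib i

fib-positive : ∀ {j} → 1 ≤ j → 1 ≤ fib j
fib-positive {suc zero} _ = ≤-refl
fib-positive {suc (suc j)} _ = ≤-trans (fib-positive {suc j} (s≤s z≤n)) (m≤m+n (fib (suc j)) (fib j))

fib-nonZero : ∀ {j} → 1 ≤ j → NonZero (fib j)
fib-nonZero 1≤j = >-nonZero (fib-positive 1≤j)

-- ρ j 1≤j e is the sequence i ↦ ρᵢ(F_j, e); the first argument is the index j
-- of the modulus, not the modulus itself.
ρ : (j : ℕ) → 1 ≤ j → (e : ℕ) → ℕ → ℕ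
ρ j 1≤j e i = _%_ (fib i ^ e) (fib j) {{fib-nonZero 1≤j}}

IsPeriod : (ℕ → ℕ) → ℕ → Set
IsPeriod a p = 1 ≤ p × (∀ i → a (i + p) ≡ a i)

IsMinimumPeriod : (ℕ → ℕ) → ℕ → Set
IsMinimumPeriod a p = IsPeriod a p × (∀ q → IsPeriod a q → p ≤ q)

-- The graph of π: π[ j , 1≤j , e ]≡ p says π(F_j, e) = p. A minimum period is
-- unique by antisymmetry of ≤, so at most one p is related to each j and e.
π[_,_,_]≡_ : (j : ℕ) → 1 ≤ j → (e : ℕ) → ℕ → Set
π[ j , 1≤j , e ]≡ p = IsMinimumPeriod (ρ j 1≤j e) p

Even : ℕ → Set
Even n = 2 ∣ n

Odd : ℕ → Set
Odd n = ¬ (2 ∣ n)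

{-# OPTIONS --safe #-}

-- With the Lucas numbers L, the identity F(m+k) + (-1)^k F(m-k) = L(k) F(m)
-- reflects indices about the zero at m = j, and F(i+2j) = F(i+1) F(2j) + F(i) F(2j-1)
-- together with F(2j-1) ≡ (-1)^j (mod F(j)) says that a shift by 2j multiplies
-- the residues by (-1)^j. Together these give every residue. The zeros among them
-- leave only multiples of j as smaller periods: j fails since F(j-1) ≠ 1, for odd j
-- 2j fails since F(j) - 1 ≠ 1, and 3j would make 4j - 3j = j a period.
module Submission where

open import Defs
open import Data.Nat using (ℕ; zero; suc; _+_; _∸_; _*_; _%_; _≤_; _<_; z≤n; s≤s; NonZero)
open import Data.Nat.DivMod
open import Data.Nat.Divisibility
open import Data.Nat.Properties
open import Data.Nat.Tactic.RingSolver using (solve-∀)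
open import Data.Product using (_×_; _,_; ∃; proj₁; proj₂)
open import Relation.Binary.Definitions using (tri<; tri≈; tri>)
open import Relation.Binary.PropositionalEquality using (_≡_; refl; sym; trans; cong; cong₂; subst; module ≡-Reasoning)
open import Relation.Nullary using (¬_; yes; no; contradiction)

-- Parity and divisibility.

∣m+n∣n⇒∣m : ∀ {d m n} → d ∣ m + n → d ∣ n → d ∣ m
∣m+n∣n⇒∣m {d} {m} {n} d∣m+n = ∣m+n∣m⇒∣n (subst (d ∣_) (+-comm m n) d∣m+n)

even⇒odd-suc : ∀ {n} → Even n → Odd (suc n)
even⇒odd-suc 2∣n 2∣1+n with ∣1⇒≡1 (∣m+n∣n⇒∣m 2∣1+n 2∣n)
... | ()

even-suc-suc : ∀ {n} → Even n → Even (2 + n)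
even-suc-suc = ∣m∣n⇒∣m+n ∣-refl

even-pred-pred : ∀ {n} → Even (2 + n) → Even n
even-pred-pred e = ∣m+n∣m⇒∣n e ∣-refl

-- `Odd` is a bare negation, so the divisor witness has to be built, by induction in steps of two.
odd⇒even-suc : ∀ {n} → Odd n → Even (suc n)
odd⇒even-suc {zero} o = contradiction (2 ∣0) o
odd⇒even-suc {suc zero} o = ∣-refl
odd⇒even-suc {suc (suc n)} o = even-suc-suc (odd⇒even-suc (λ e → o (even-suc-suc e)))

even-suc⇒odd : ∀ {n} → Even (suc n) → Odd n
even-suc⇒odd e e′ = even⇒odd-suc e′ e

odd-suc⇒even : ∀ {n} → Odd (suc n) → Even n
odd-suc⇒even o = even-pred-pred (odd⇒even-suc o)

odd+odd : ∀ {m n} → Odd m → Odd n → Even (m + n)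
odd+odd {m} {n} om on = even-pred-pred
  (subst (2 ∣_) (cong suc (+-suc m n)) (∣m∣n⇒∣m+n (odd⇒even-suc om) (odd⇒even-suc on)))

-- Residues of opposite numbers modulo `d`.

module _ {d : ℕ} .{{_ : NonZero d}} where

  -- Since `b` is positive, so is the quotient; splitting one `d` off it leaves `d ∸ b` plus a
  -- multiple of `d`. At `b = 0` the value `d ∸ b` would not be a residue.
  ∣+⇒%≡∸ : ∀ {a b} → d ∣ a + b → 0 < b → b ≤ d → a % d ≡ d ∸ b
  ∣+⇒%≡∸ {a} {b} (divides zero eq) 0<b b≤d = contradiction 0<b (<-irrefl (sym (m+n≡0⇒n≡0 a eq)))
  ∣+⇒%≡∸ {a} {b} (divides (suc q) eq) 0<b b≤d = begin
    a % d                 ≡⟨ cong (_% d) (+-cancelʳ-≡ b a (d ∸ b + q * d) a+b≡) ⟩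
    (d ∸ b + q * d) % d   ≡⟨ [m+kn]%n≡m%n (d ∸ b) q d ⟩
    (d ∸ b) % d           ≡⟨ m<n⇒m%n≡m (∸-monoʳ-< 0<b b≤d) ⟩
    d ∸ b                 ∎
    where
    open ≡-Reasoning
    swap : ∀ x y z → x + y + z ≡ x + z + y
    swap = solve-∀
    a+b≡ : a + b ≡ d ∸ b + q * d + b
    a+b≡ = begin
      a + b                 ≡⟨ eq ⟩
      d + q * d             ≡⟨ cong (_+ q * d) (m∸n+n≡m b≤d) ⟨
      d ∸ b + b + q * d     ≡⟨ swap (d ∸ b) b (q * d) ⟩
      d ∸ b + q * d + b     ∎

  ∣+-% : ∀ a b → d ∣ a + b → d ∣ a + b % d
  ∣+-% a b d∣a+b = ∣m+n∣n⇒∣m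
    (subst (d ∣_) (trans (cong (a +_) (m≡m%n+[m/n]*n b d)) (sym (+-assoc a (b % d) _))) d∣a+b)
    (n∣m*n (b / d))

  -- Both `a` and `c` are congruent to `-b`: reduce `a + b + c` under its two bracketings.
  opposites⇒%≡ : ∀ a b c → d ∣ a + b → d ∣ b + c → a % d ≡ c % d
  opposites⇒%≡ a b c d∣a+b d∣b+c = begin
    a % d               ≡⟨ %-remove-+ʳ a d∣b+c ⟨
    (a + (b + c)) % d   ≡⟨ cong (_% d) (+-assoc a b c) ⟨
    (a + b + c) % d     ≡⟨ %-remove-+ˡ c d∣a+b ⟩
    c % d               ∎
    where open ≡-Reasoning

-- Addition formula and monotonicity of Fibonacci numbers.

fib-add : ∀ i p → fib (i + suc p) ≡ fib (suc i) * fib (suc p) + fib i * fib p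
fib-add zero p = sym (trans (+-identityʳ _) (*-identityˡ _))
fib-add (suc zero) p = sym (cong₂ _+_ (*-identityˡ (fib (suc p))) (*-identityˡ (fib p)))
fib-add (suc (suc i)) p =
  trans (cong₂ _+_ (fib-add (suc i) p) (fib-add i p))
        (regroup (fib (suc i)) (fib i) (fib (suc p)) (fib p))
  where
  regroup : ∀ a b x y → ((a + b) * x + a * y) + (a * x + b * y) ≡ (a + b + a) * x + (a + b) * y
  regroup = solve-∀

fib-mono : ∀ {m n} → m ≤ n → fib m ≤ fib n
fib-mono z≤n = z≤n
fib-mono {n = suc n} (s≤s {zero} z≤n) = fib-positive {suc n} (s≤s z≤n)
fib-mono (s≤s (s≤s m≤n)) = +-mono-≤ (fib-mono (s≤s m≤n)) (fib-mono m≤n)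

fib-<-suc : ∀ {n} → 2 ≤ n → fib n < fib (suc n)
fib-<-suc {suc n} (s≤s 1≤n) = m<m+n (fib (suc n)) (fib-positive 1≤n)

-- The bound `3 ≤ n` rules out the one tie, F(1) = F(2).
fib-mono-< : ∀ {m n} → 3 ≤ n → m < n → fib m < fib n
fib-mono-< (s≤s 2≤n) (s≤s m≤n) = ≤-<-trans (fib-mono m≤n) (fib-<-suc 2≤n)

-- Lucas numbers and the reflection identity.

lucas : ℕ → ℕ
lucas 0 = 2
lucas 1 = 1
lucas (suc (suc k)) = lucas (suc k) + lucas k

+-suc-suc : ∀ k {d m} → suc (suc k) + d ≡ m → k + suc (suc d) ≡ m
+-suc-suc k {d} k+d≡m = trans (+-suc k (suc d)) (trans (cong suc (+-suc k d)) k+d≡m)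

mutual
  -- The sign (-1)^k becomes a choice of side, hence one lemma per parity, and `d` with `k + d ≡ m`
  -- stands for m - k. The step from `k` to `k + 2` uses both parities, as `k + 1` goes with `d + 1`
  -- and `k` with `d + 2`.
  reflect-even : ∀ k {d m} → k + d ≡ m → Even k → fib (k + m) + fib d ≡ lucas k * fib m
  reflect-even zero {d} refl _ = cong (fib d +_) (sym (+-identityʳ (fib d)))
  reflect-even (suc zero) _ e = contradiction e (even⇒odd-suc (2 ∣0))
  reflect-even (suc (suc k)) {d} {m} k+d≡m e = begin
    A + B + fib d                                ≡⟨ cong (λ x → x + B + fib d) (reflect-odd (suc k) (trans (+-suc (suc k) d) k+d≡m) (even-suc⇒odd e)) ⟩
    -- The F(d+1) left by the odd case joins F(d) to form F(d+2), the reflected term for `k`.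
    L₁ * M + fib (suc d) + B + fib d             ≡⟨ regroup (L₁ * M) (fib (suc d)) B (fib d) ⟩
    L₁ * M + (B + (fib (suc d) + fib d))         ≡⟨ cong (L₁ * M +_) (reflect-even k (+-suc-suc k k+d≡m) (even-pred-pred e)) ⟩
    L₁ * M + L₀ * M                              ≡⟨ *-distribʳ-+ M L₁ L₀ ⟨
    (L₁ + L₀) * M                                ∎
    where
    open ≡-Reasoning
    A = fib (suc k + m) ; B = fib (k + m) ; M = fib m
    L₁ = lucas (suc k) ; L₀ = lucas k
    regroup : ∀ x y z w → x + y + z + w ≡ x + (z + (y + w))
    regroup = solve-∀

  reflect-odd : ∀ k {d m} → k + d ≡ m → Odd k → fib (k + m) ≡ lucas k * fib m + fib d
  reflect-odd zero _ o = contradiction (2 ∣0) o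
  reflect-odd (suc zero) {d} refl _ = cong (_+ fib d) (sym (*-identityˡ (fib (suc d))))
  reflect-odd (suc (suc k)) {d} {m} k+d≡m o = begin
    A + B                                        ≡⟨ cong (A +_) (reflect-odd k (+-suc-suc k k+d≡m) (λ e → o (even-suc-suc e))) ⟩
    A + (L₀ * M + (fib (suc d) + fib d))         ≡⟨ regroup A (L₀ * M) (fib (suc d)) (fib d) ⟩
    A + fib (suc d) + L₀ * M + fib d             ≡⟨ cong (λ x → x + L₀ * M + fib d) (reflect-even (suc k) (trans (+-suc (suc k) d) k+d≡m) (odd-suc⇒even o)) ⟩
    L₁ * M + L₀ * M + fib d                      ≡⟨ cong (_+ fib d) (*-distribʳ-+ M L₁ L₀) ⟨
    (L₁ + L₀) * M + fib d                        ∎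
    where
    open ≡-Reasoning
    A = fib (suc k + m) ; B = fib (k + m) ; M = fib m
    L₁ = lucas (suc k) ; L₀ = lucas k
    regroup : ∀ x y z w → x + (y + (z + w)) ≡ x + z + y + w
    regroup = solve-∀

IsPeriod-∸ : ∀ {a p q} → IsPeriod a p → IsPeriod a q → q < p → IsPeriod a (p ∸ q)
IsPeriod-∸ {a} {p} {q} (_ , perₚ) (_ , per_q) q<p = m<n⇒0<n∸m q<p , λ i → begin
  a (i + (p ∸ q))       ≡⟨ per_q _ ⟨
  a (i + (p ∸ q) + q)   ≡⟨ cong a (trans (+-assoc i _ q) (cong (i +_) (m∸n+n≡m (<⇒≤ q<p)))) ⟩
  a (i + p)             ≡⟨ perₚ i ⟩
  a i                   ∎
  where open ≡-Reasoning

-- Residues modulo F(j) and the shift by 2j.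

module Residues (j-1 : ℕ) (4≤j : 4 ≤ suc j-1) where

  -- Starting from the predecessor lets F(j-1) and F(2j-1) be written without truncated subtraction.
  j = suc j-1

  1≤j : 1 ≤ j
  1≤j = ≤-trans (s≤s z≤n) 4≤j

  3≤j : 3 ≤ j
  3≤j = ≤-trans (n≤1+n 3) 4≤j

  instance
    fib-j-nonZero : NonZero (fib j)
    fib-j-nonZero = fib-nonZero 1≤j

  r : ℕ → ℕ
  r = ρ j 1≤j 1

  r≡% : ∀ i → r i ≡ fib i % fib j
  r≡% i = cong (_% fib j) (*-identityʳ (fib i))

  r-small : ∀ i → i < j → r i ≡ fib i
  r-small i i<j = trans (r≡% i) (m<n⇒m%n≡m (fib-mono-< 3≤j i<j))

  ∣⇒r≡0 : ∀ i → fib j ∣ fib i → r i ≡ 0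
  ∣⇒r≡0 i d = trans (r≡% i) (n∣m⇒m%n≡0 (fib i) (fib j) d)

  r≡0⇒∣ : ∀ i → r i ≡ 0 → fib j ∣ fib i
  r≡0⇒∣ i e = m%n≡0⇒n∣m (fib i) (fib j) (trans (sym (r≡% i)) e)

  2*j≡j+j : 2 * j ≡ j + j
  2*j≡j+j = cong (j +_) (+-identityʳ j)

  fib-j∣fib-2j : fib j ∣ fib (2 * j)
  fib-j∣fib-2j = subst (λ n → fib j ∣ fib n) (sym 2*j≡j+j)
    (subst (fib j ∣_) (sym (fib-add j j-1)) (∣m∣n⇒∣m+n (n∣m*n (fib (suc j))) (m∣m*n (fib j-1))))

  -- This is `fib-add` with p = 2j-1, written `j-1 + j`, whose successor computes to `j + j`.
  fib-shift : ∀ i → fib (i + 2 * j) ≡ fib (suc i) * fib (2 * j) + fib i * fib (j-1 + j)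
  fib-shift i = subst (λ n → fib (i + n) ≡ fib (suc i) * fib n + fib i * fib (j-1 + j))
    (sym 2*j≡j+j) (fib-add i (j-1 + j))

  r-shift-even : Even j → ∀ i → r (i + 2 * j) ≡ r i
  r-shift-even ev i = begin
    r (i + 2 * j)                                                       ≡⟨ r≡% (i + 2 * j) ⟩
    fib (i + 2 * j) % F                                                 ≡⟨ cong (_% F) (fib-shift i) ⟩
    (fib (suc i) * fib (2 * j) + fib i * fib (j-1 + j)) % F             ≡⟨ %-remove-+ˡ _ (∣n⇒∣m*n (fib (suc i)) fib-j∣fib-2j) ⟩
    (fib i * fib (j-1 + j)) % F                                         ≡⟨ cong (λ x → (fib i * x) % F) fib-2j-1 ⟩
    (fib i * (lucas j-1 * F + 1)) % F                                   ≡⟨ cong (_% F) (regroup (fib i) (lucas j-1) F) ⟩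
    (fib i + fib i * lucas j-1 * F) % F                                 ≡⟨ [m+kn]%n≡m%n (fib i) (fib i * lucas j-1) F ⟩
    fib i % F                                                           ≡⟨ r≡% i ⟨
    r i                                                                 ∎
    where
    open ≡-Reasoning
    F = fib j
    -- Reflection about j at distance j-1, which is odd, leaves F(1) = 1.
    fib-2j-1 : fib (j-1 + j) ≡ lucas j-1 * F + 1
    fib-2j-1 = reflect-odd j-1 {1} (+-comm j-1 1) (even-suc⇒odd ev)
    regroup : ∀ x l m → x * (l * m + 1) ≡ x + x * l * m
    regroup = solve-∀

  -- Divisibility of the sum expresses F(i+2j) ≡ -F(i) within the naturals. Now j-1 is even, so the
  -- reflected F(1) sits on the left and F(2j-1) ≡ -1.
  fib-shift-odd : Odd j → ∀ i → fib j ∣ fib (i + 2 * j) + fib i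
  fib-shift-odd od i = subst (fib j ∣_) (sym sum≡)
    (∣m∣n⇒∣m+n (∣n⇒∣m*n (fib (suc i)) fib-j∣fib-2j) (n∣m*n (fib i * lucas j-1)))
    where
    open ≡-Reasoning
    fib-2j-1 : fib (j-1 + j) + 1 ≡ lucas j-1 * fib j
    fib-2j-1 = reflect-even j-1 {1} (+-comm j-1 1) (odd-suc⇒even od)
    regroup : ∀ a x y → a + x * y + x ≡ a + x * (y + 1)
    regroup = solve-∀
    A = fib (suc i) * fib (2 * j)
    sum≡ : fib (i + 2 * j) + fib i ≡ A + fib i * lucas j-1 * fib j
    sum≡ = begin
      fib (i + 2 * j) + fib i                  ≡⟨ cong (_+ fib i) (fib-shift i) ⟩
      A + fib i * fib (j-1 + j) + fib i        ≡⟨ regroup A (fib i) (fib (j-1 + j)) ⟩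
      A + fib i * (fib (j-1 + j) + 1)          ≡⟨ cong (λ x → A + fib i * x) fib-2j-1 ⟩
      A + fib i * (lucas j-1 * fib j)          ≡⟨ cong (A +_) (*-assoc (fib i) (lucas j-1) (fib j)) ⟨
      A + fib i * lucas j-1 * fib j            ∎

  r-shift-odd : Odd j → ∀ i → 0 < r i → r (i + 2 * j) ≡ fib j ∸ r i
  r-shift-odd od i 0<r = trans (r≡% (i + 2 * j)) (∣+⇒%≡∸ ∣sum 0<r (<⇒≤ (m%n<n _ (fib j))))
    where
    ∣sum : fib j ∣ fib (i + 2 * j) + r i
    ∣sum = subst (λ x → fib j ∣ fib (i + 2 * j) + x) (sym (r≡% i)) (∣+-% (fib (i + 2 * j)) (fib i) (fib-shift-odd od i))

  4*j≡2*j+2*j : 4 * j ≡ 2 * j + 2 * j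
  4*j≡2*j+2*j = *-distribʳ-+ j 2 2

  r-shift-shift-odd : Odd j → ∀ i → r (i + 4 * j) ≡ r i
  r-shift-shift-odd od i = begin
    r (i + 4 * j)                      ≡⟨ cong r (trans (cong (i +_) 4*j≡2*j+2*j) (sym (+-assoc i (2 * j) (2 * j)))) ⟩
    r (i + 2 * j + 2 * j)              ≡⟨ r≡% (i + 2 * j + 2 * j) ⟩
    fib (i + 2 * j + 2 * j) % fib j    ≡⟨ opposites⇒%≡ (fib (i + 2 * j + 2 * j)) (fib (i + 2 * j)) (fib i) (fib-shift-odd od (i + 2 * j)) (fib-shift-odd od i) ⟩
    fib i % fib j                      ≡⟨ r≡% i ⟨
    r i                                ∎
    where open ≡-Reasoning

  -- Reflection about j: the residues between j and 2j.

  between : ∀ i → j < i → i < 2 * j →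
    ∃ λ k → i ≡ k + j × k + (2 * j ∸ i) ≡ j × 0 < 2 * j ∸ i × 2 * j ∸ i < j
  between i j<i i<2j = k , i≡k+j , k+d≡j , m<n⇒0<n∸m i<2j , subst (d <_) k+d≡j (m<n+m d (m<n⇒0<n∸m j<i))
    where
    open ≡-Reasoning
    k = i ∸ j
    d = 2 * j ∸ i
    i≡k+j : i ≡ k + j
    i≡k+j = sym (m∸n+n≡m (<⇒≤ j<i))
    k+d≡j : k + d ≡ j
    k+d≡j = +-cancelˡ-≡ j (k + d) j (begin
      j + (k + d)   ≡⟨ +-assoc j k d ⟨
      j + k + d     ≡⟨ cong (_+ d) (trans (+-comm j k) (sym i≡k+j)) ⟩
      i + d         ≡⟨ m+[n∸m]≡n (<⇒≤ i<2j) ⟩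
      2 * j         ≡⟨ 2*j≡j+j ⟩
      j + j         ∎)

  r-reflect-odd : ∀ k d → k + d ≡ j → d < j → Odd k → r (k + j) ≡ fib d
  r-reflect-odd k d k+d≡j d<j ok = begin
    r (k + j)                          ≡⟨ r≡% (k + j) ⟩
    fib (k + j) % fib j                ≡⟨ cong (_% fib j) (reflect-odd k k+d≡j ok) ⟩
    (lucas k * fib j + fib d) % fib j  ≡⟨ %-remove-+ˡ (fib d) (n∣m*n (lucas k)) ⟩
    fib d % fib j                      ≡⟨ m<n⇒m%n≡m (fib-mono-< 3≤j d<j) ⟩
    fib d                              ∎
    where open ≡-Reasoning

  r-reflect-even : ∀ k d → k + d ≡ j → 0 < d → d < j → Even k → r (k + j) ≡ fib j ∸ fib d
  r-reflect-even k d k+d≡j 0<d d<j ek = trans (r≡% (k + j))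
    (∣+⇒%≡∸ (divides (lucas k) (reflect-even k k+d≡j ek)) (fib-positive 0<d) (fib-mono (<⇒≤ d<j)))

  -- The parity of the offset `k` from j decides the sign; it equals that of `i + j`, a form that
  -- serves both parities of j.
  r-second-opposite : ∀ i → j < i → i < 2 * j → Odd (i + j) → r i ≡ fib (2 * j ∸ i)
  r-second-opposite i j<i i<2j o with between i j<i i<2j
  ... | k , i≡k+j , k+d≡j , _ , d<j = trans (cong r i≡k+j) (r-reflect-odd k _ k+d≡j d<j
    λ ek → o (subst (λ n → 2 ∣ n + j) (sym i≡k+j) (even-k+j+j ek)))
    where
    even-k+j+j : ∀ {k} → Even k → Even (k + j + j)
    even-k+j+j {k} ek = subst (2 ∣_) (sym (+-assoc k j j)) (∣m∣n⇒∣m+n ek (subst (2 ∣_) 2*j≡j+j (m∣m*n j)))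

  r-second-same : ∀ i → j < i → i < 2 * j → Even (i + j) → r i ≡ fib j ∸ fib (2 * j ∸ i)
  r-second-same i j<i i<2j e with between i j<i i<2j
  ... | k , i≡k+j , k+d≡j , 0<d , d<j = trans (cong r i≡k+j) (r-reflect-even k _ k+d≡j 0<d d<j
    (∣m+n∣n⇒∣m (subst (2 ∣_) (trans (cong (_+ j) i≡k+j) (+-assoc k j j)) e) (subst (2 ∣_) 2*j≡j+j (m∣m*n j))))

  fib∸fib-positive : ∀ {d} → d < j → 0 < fib j ∸ fib d
  fib∸fib-positive d<j = m<n⇒0<n∸m (fib-mono-< 3≤j d<j)

  -- Zeros and minimum periods.

  r-zero-below-2j : ∀ q → 1 ≤ q → q < 2 * j → r q ≡ 0 → q ≡ j
  r-zero-below-2j q 1≤q q<2j rq≡0 with <-cmp q j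
  ... | tri< q<j _ _ = contradiction (trans (sym (r-small q q<j)) rq≡0) (>⇒≢ (fib-positive 1≤q))
  ... | tri≈ _ q≡j _ = q≡j
  ... | tri> _ _ j<q with between q j<q q<2j | 2 ∣? (q + j)
  ...   | _ , _ , _ , 0<d , d<j | yes e = contradiction (trans (sym (r-second-same q j<q q<2j e)) rq≡0) (>⇒≢ (fib∸fib-positive d<j))
  ...   | _ , _ , _ , 0<d , d<j | no o = contradiction (trans (sym (r-second-opposite q j<q q<2j o)) rq≡0) (>⇒≢ (fib-positive 0<d))

  r-0 : r 0 ≡ 0
  r-0 = r-small 0 1≤j

  r-1 : r 1 ≡ 1
  r-1 = r-small 1 (≤-trans (s≤s (s≤s z≤n)) 4≤j)

  -- Index 0 is a zero, so only zeros of the sequence can be periods.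
  r-period-zero : ∀ {q} → IsPeriod r q → r q ≡ 0
  r-period-zero (_ , per) = trans (per 0) r-0

  -- Compare indices 1 and 1+j: the latter has residue F(j-1), at least F(3) = 2 because `4 ≤ j`.
  j-not-period : ¬ IsPeriod r j
  j-not-period (_ , per) = contradiction
    (trans (sym (trans (per 1) r-1)) (r-reflect-odd 1 j-1 refl ≤-refl (even⇒odd-suc (2 ∣0))))
    (<⇒≢ (fib-mono (≤-pred 4≤j)))

  r-j : r j ≡ 0
  r-j = ∣⇒r≡0 j ∣-refl

  2j-not-period : Odd j → ¬ IsPeriod r (2 * j)
  2j-not-period od (_ , per) = contradiction (begin
    1             ≡⟨ r-1 ⟨
    r 1           ≡⟨ per 1 ⟨
    r (1 + 2 * j) ≡⟨ r-shift-odd od 1 (subst (0 <_) (sym r-1) (s≤s z≤n)) ⟩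
    fib j ∸ r 1   ≡⟨ cong (fib j ∸_) r-1 ⟩
    -- F(j) - 1 is at least F(4) - 1 = 2.
    fib j ∸ 1     ∎) (<⇒≢ (∸-monoˡ-≤ 1 (fib-mono 4≤j)))
    where open ≡-Reasoning

  -- Zeros are excluded from `r-shift-odd`, so they are carried along the shift by divisibility.
  r-shift-zero : Odd j → ∀ i → r i ≡ 0 → r (i + 2 * j) ≡ 0
  r-shift-zero od i ri≡0 = ∣⇒r≡0 (i + 2 * j) (∣m+n∣n⇒∣m (fib-shift-odd od i) (r≡0⇒∣ i ri≡0))

  r-unshift-zero : Odd j → ∀ i → r (i + 2 * j) ≡ 0 → r i ≡ 0
  r-unshift-zero od i e = ∣⇒r≡0 i (∣m+n∣m⇒∣n (fib-shift-odd od i) (r≡0⇒∣ (i + 2 * j) e))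

  π-even : Even j → IsMinimumPeriod r (2 * j)
  π-even ev = (≤-trans 1≤j (m≤m+n j _) , r-shift-even ev) , minimal
    where
    minimal : ∀ q → IsPeriod r q → 2 * j ≤ q
    minimal q per with q <? 2 * j
    ... | no q≮2j = ≮⇒≥ q≮2j
    ... | yes q<2j = contradiction
      (subst (IsPeriod r) (r-zero-below-2j q (proj₁ per) q<2j (r-period-zero per)) per) j-not-period

  below-4j : ∀ {i} → i < 4 * j → i ∸ 2 * j < 2 * j
  below-4j {i} i<4j = m<n+o⇒m∸n<o i (2 * j) (subst (i <_) 4*j≡2*j+2*j i<4j)

  π-odd : Odd j → IsMinimumPeriod r (4 * j)
  π-odd od = 4j-period , minimal
    where
    4j-period : IsPeriod r (4 * j)
    4j-period = ≤-trans 1≤j (m≤m+n j _) , r-shift-shift-odd od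

    minimal : ∀ q → IsPeriod r q → 4 * j ≤ q
    minimal q per with q <? 4 * j
    ... | no q≮4j = ≮⇒≥ q≮4j
    ... | yes q<4j with <-cmp q (2 * j)
    ...   | tri< q<2j _ _ = contradiction
      (subst (IsPeriod r) (r-zero-below-2j q (proj₁ per) q<2j (r-period-zero per)) per) j-not-period
    ...   | tri≈ _ q≡2j _ = contradiction (subst (IsPeriod r) q≡2j per) (2j-not-period od)
    ...   | tri> _ _ 2j<q = contradiction (subst (IsPeriod r) 4j∸q≡j (IsPeriod-∸ 4j-period per q<4j)) j-not-period
      where
      -- Shifting the zero at `q` back by 2j gives a zero strictly between 0 and 2j, which can only
      -- be j.
      q∸2j≡j : q ∸ 2 * j ≡ j
      q∸2j≡j = r-zero-below-2j (q ∸ 2 * j) (m<n⇒0<n∸m 2j<q) (below-4j q<4j)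
        (r-unshift-zero od (q ∸ 2 * j) (trans (cong r (m∸n+n≡m (<⇒≤ 2j<q))) (r-period-zero per)))
      4j∸q≡j : 4 * j ∸ q ≡ j
      -- By computation `4 * j` is `j + 3 * j` and `j + 2 * j` is `3 * j`.
      4j∸q≡j = trans (cong (4 * j ∸_) (trans (sym (m∸n+n≡m (<⇒≤ 2j<q))) (cong (_+ 2 * j) q∸2j≡j))) (m+n∸n≡m j (3 * j))

  -- Residues beyond 2j for odd j.

  r-shift-odd′ : Odd j → ∀ {i v} → 2 * j < i → r (i ∸ 2 * j) ≡ v → 0 < v → r i ≡ fib j ∸ v
  r-shift-odd′ od {i} 2j<i refl 0<v =
    trans (cong r (sym (m∸n+n≡m (<⇒≤ 2j<i)))) (r-shift-odd od (i ∸ 2 * j) 0<v)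

  -- Going back by 2j lands between j and 2j, keeps the parity, and turns the distance to 4j into
  -- the distance to 2j.
  module Fourth {i} (3j<i : 3 * j < i) (i<4j : i < 4 * j) where
    2j<i : 2 * j < i
    2j<i = ≤-<-trans (m≤n+m (2 * j) j) 3j<i
    i′ = i ∸ 2 * j
    j<i′ : j < i′
    j<i′ = m+n≤o⇒m≤o∸n (suc j) 3j<i
    i′<2j : i′ < 2 * j
    i′<2j = below-4j i<4j
    i′+2j≡i : i′ + 2 * j ≡ i
    i′+2j≡i = m∸n+n≡m (<⇒≤ 2j<i)
    2j∸i′≡4j∸i : 2 * j ∸ i′ ≡ 4 * j ∸ i
    2j∸i′≡4j∸i = begin
      2 * j ∸ i′                        ≡⟨ [m+n]∸[m+o]≡n∸o (2 * j) (2 * j) i′ ⟨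
      2 * j + 2 * j ∸ (2 * j + i′)      ≡⟨ cong₂ _∸_ (sym 4*j≡2*j+2*j) (trans (+-comm (2 * j) i′) i′+2j≡i) ⟩
      4 * j ∸ i                         ∎
      where open ≡-Reasoning
    even-i′⇒even-i : Even i′ → Even i
    even-i′⇒even-i e = subst (2 ∣_) i′+2j≡i (∣m∣n⇒∣m+n e (m∣m*n j))
    even-i⇒even-i′ : Even i → Even i′
    even-i⇒even-i′ e = ∣m+n∣n⇒∣m (subst (2 ∣_) (sym i′+2j≡i) e) (m∣m*n j)
    0<d×d<j : 0 < 2 * j ∸ i′ × 2 * j ∸ i′ < j
    0<d×d<j with between i′ j<i′ i′<2j
    ... | _ , _ , _ , p = p

theorem1 : (j : ℕ) (4≤j : 4 ≤ j) →
  let 1≤j = ≤-trans (s≤s z≤n) 4≤j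
      ρ₁ = ρ j 1≤j 1
  in
  (Even j →
    (π[ j , 1≤j , 1 ]≡ (2 * j)) ×
    (∀ i → i < j → ρ₁ i ≡ fib i) ×
    (∀ i → i ≡ j → ρ₁ i ≡ 0) ×
    (∀ i → j < i → i < 2 * j → Odd i → ρ₁ i ≡ fib (2 * j ∸ i)) ×
    (∀ i → j < i → i < 2 * j → Even i → ρ₁ i ≡ fib j ∸ fib (2 * j ∸ i))) ×
  (Odd j →
    (π[ j , 1≤j , 1 ]≡ (4 * j)) ×
    (∀ i → i < j → ρ₁ i ≡ fib i) ×
    (∀ i → i ≡ j → ρ₁ i ≡ 0) ×
    (∀ i → j < i → i < 2 * j → Even i → ρ₁ i ≡ fib (2 * j ∸ i)) ×
    (∀ i → j < i → i < 2 * j → Odd i → ρ₁ i ≡ fib j ∸ fib (2 * j ∸ i)) ×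
    (∀ i → i ≡ 2 * j → ρ₁ i ≡ 0) ×
    (∀ i → 2 * j < i → i < 3 * j → ρ₁ i ≡ fib j ∸ fib (i ∸ 2 * j)) ×
    (∀ i → i ≡ 3 * j → ρ₁ i ≡ 0) ×
    (∀ i → 3 * j < i → i < 4 * j → Even i → ρ₁ i ≡ fib j ∸ fib (4 * j ∸ i)) ×
    (∀ i → 3 * j < i → i < 4 * j → Odd i → ρ₁ i ≡ fib (4 * j ∸ i)))
theorem1 (suc j-1) 4≤j = even-part , odd-part
  where
  open Residues j-1 4≤j

  even-part = λ ev →
    π-even ev ,
    r-small ,
    (λ { _ refl → r-j }) ,
    (λ i j<i i<2j oi → r-second-opposite i j<i i<2j (λ e → oi (∣m+n∣n⇒∣m e ev))) ,
    (λ i j<i i<2j ei → r-second-same i j<i i<2j (∣m∣n⇒∣m+n ei ev))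

  odd-part = λ od →
    π-odd od ,
    r-small ,
    (λ { _ refl → r-j }) ,
    (λ i j<i i<2j ei → r-second-opposite i j<i i<2j (λ e → od (∣m+n∣m⇒∣n e ei))) ,
    (λ i j<i i<2j oi → r-second-same i j<i i<2j (odd+odd oi od)) ,
    (λ { _ refl → ∣⇒r≡0 (2 * j) fib-j∣fib-2j }) ,
    (λ i 2j<i i<3j → r-shift-odd′ od 2j<i
      (r-small _ (m<n+o⇒m∸n<o i (2 * j) (subst (i <_) (+-comm j (2 * j)) i<3j)))
      (fib-positive (m<n⇒0<n∸m 2j<i))) ,
    -- `3 * j` computes to `j + 2 * j`, the shift of the zero at j.
    (λ { _ refl → r-shift-zero od j r-j }) ,
    (λ i 3j<i i<4j ei → let open Fourth 3j<i i<4j in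
      trans (r-shift-odd′ od 2j<i
              (r-second-opposite i′ j<i′ i′<2j (λ e → od (∣m+n∣m⇒∣n e (even-i⇒even-i′ ei))))
              (fib-positive (proj₁ 0<d×d<j)))
            (cong (λ x → fib j ∸ fib x) 2j∸i′≡4j∸i)) ,
    (λ i 3j<i i<4j oi → let open Fourth 3j<i i<4j in
      trans (r-shift-odd′ od 2j<i
              (r-second-same i′ j<i′ i′<2j (odd+odd (λ e → oi (even-i′⇒even-i e)) od))
              (fib∸fib-positive (proj₂ 0<d×d<j)))
            -- The residue at `i′` is already a complement in F(j), and the shift complements it
            -- again, which restores the Fibonacci number.
            (trans (m∸[m∸n]≡n (<⇒≤ (fib-mono-< 3≤j (proj₂ 0<d×d<j))))
                   (cong fib 2j∸i′≡4j∸i)))
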